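{- Let $(\mathbb{F}_i,\star_i)$ and $(\mathbb{F}_j,\star_j)$ be free magmas with generator sets $X_i$ and $X_j$ respectively, where $|X_i|=|X_j|$, and let $\sigma:X_i\to X_j$ be any bijection. Let $\Upsilon_{i,j}:\mathbb{F}_i\to\mathbb{F}_j$ be the universal bijection map determined by $\sigma$. Then $\Upsilon_{i,j}$ is an isomorphism of (free) magmas.
   Context: A magma $(\mathcal{M},\star)$ is a non-empty countable set $\mathcal{M}$ together with a map $\star:\mathcal{M}\times\mathcal{M}\to\mathcal{M}$ (no further conditions). A magma morphism $\theta:(\mathcal{M},\star)\to(\mathcal{N},\bullet)$ is a map with $\theta(m\star m')=\theta(m)\bullet\theta(m')$ for all $m,m'\in\mathcal{M}$; an isomorphism is a morphism having a two-sided inverse morphism. A magma $(\mathcal{M},\star)$ is free if there exist a set $\mathcal{Y}$ and a map $\iota:\mathcal{Y}\to\mathcal{M}$ such that for every magma $(\mathcal{N},\bullet)$ and every map $f:\mathcal{Y}\to\mathcal{N}$ there is a unique magma morphism $\theta:\mathcal{M}\to\mathcal{N}$ with $f=\theta\circ\iota$. The image $\iota(\mathcal{Y})\subseteq\mathcal{M}$ is called the set of generators of $\mathcal{M}$. Definition of $\Upsilon_{i,j}$ (the universal bijection determined by $\sigma$): for $x\in X_i$, $\Upsilon_{i,j}(x)=\sigma(x)$. For $u\in\mathbb{F}_i\setminus X_i$: (1) decompose $u$ into a (fully bracketed) product, with respect to $\star_i$, of generators in $X_i$ (in a free magma each element has exactly one such decomposition); (2) in this decomposition replace every occurrence of each generator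 $\varepsilon\in X_i$ by $\sigma(\varepsilon)$ and every occurrence of $\star_i$ by $\star_j$, giving an expression $w(u)$; (3) $\Upsilon_{i,j}(u)$ is the element of $\mathbb{F}_j$ obtained by evaluating all the products in $w(u)$. -}

module Defs where

open import Algebra.Bundles using (Magma)
open import Algebra.Morphism.Bundles using (MagmaHomomorphism)
open import Algebra.Morphism.Structures using (IsMagmaHomomorphism)
open import Data.Bool.Base using (Bool; true; false; not)
open import Data.Nat.Base using (ℕ; zero; suc; _+_; _*_)
open import Data.Nat.Properties using (suc-injective; *-cancelˡ-≡; even≢odd)
open import Data.Product using (∃; ∃!; _×_; _,_; proj₁; proj₂)
open import Data.Sum.Base using (_⊎_; inj₁; inj₂)
open import Data.Sum.Relation.Binary.Pointwise using (_⊎ₛ_; inj₁; inj₂)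
open import Function.Bundles using (Func; Injection; Bijection)
open import Level using (Level) renaming (suc to lsuc)
open import Relation.Binary.Bundles using (Setoid)
open import Relation.Binary.PropositionalEquality as ≡ using (_≡_)
open import Relation.Nullary.Negation using (contradiction)
import Relation.Binary.Construct.On as On

private
  variable
    ℓ : Level

-- Sets are setoids, and "countable" means finite or countably infinite:
-- there is an injection into ℕ.
Countable : Setoid ℓ ℓ → Set ℓ
Countable S = Injection S (≡.setoid ℕ)

record CountableMagma (ℓ : Level) : Set (lsuc ℓ) where
  field
    magma     : Magma ℓ ℓ
  open Magma magma public
  field
    point     : Carrier
    countable : Countable setoid

Morphism : (M N : CountableMagma ℓ) → Set ℓ
Morphism M N = MagmaHomomorphism (CountableMagma.rawMagma M) (CountableMagma.rawMagma N)

record IsIsomorphism (M N : CountableMagma ℓ)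
    (f : CountableMagma.Carrier M → CountableMagma.Carrier N) : Set ℓ where
  private
    module M = CountableMagma M
    module N = CountableMagma N
  field
    isMagmaHomomorphism : IsMagmaHomomorphism M.rawMagma N.rawMagma f
    inverse             : Morphism N M
  open MagmaHomomorphism inverse using () renaming (⟦_⟧ to f⁻¹)
  field
    inverseˡ : ∀ n → f (f⁻¹ n) N.≈ n
    inverseʳ : ∀ m → f⁻¹ (f m) M.≈ m

IsFree : (M : CountableMagma ℓ) (Y : Setoid ℓ ℓ) →
         Func Y (CountableMagma.setoid M) → Set (lsuc ℓ)
IsFree {ℓ} M Y ι =
  (N : CountableMagma ℓ) (f : Func Y (CountableMagma.setoid N)) →
  let open CountableMagma N using (_≈_)
      open MagmaHomomorphism using (⟦_⟧)
  in ∃! (λ (θ θ′ : Morphism M N) → ∀ m → ⟦ θ ⟧ m ≈ ⟦ θ′ ⟧ m)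
        (λ θ → ∀ y → ⟦ θ ⟧ (Func.to ι y) ≈ Func.to f y)

record FreeMagma (ℓ : Level) : Set (lsuc ℓ) where
  field
    countableMagma : CountableMagma ℓ
  open CountableMagma countableMagma public
  field
    Y      : Setoid ℓ ℓ
    ι      : Func Y setoid
    isFree : IsFree countableMagma Y ι

-- The image of ι.  Generators are compared as elements of the magma; the
-- preimage under ι is irrelevant for equality.
Generators : FreeMagma ℓ → Setoid ℓ ℓ
Generators F = On.setoid setoid (proj₁ {B = λ m → ∃ λ y → Func.to ι y ≈ m})
  where open FreeMagma F

infixl 7 _·_
infix  4 _⊢_≋_

-- Fully bracketed products of elements of A.
data Expr (A : Set ℓ) : Set ℓ where
  leaf : A → Expr A
  _·_  : Expr A → Expr A → Expr A

data _⊢_≋_ (S : Setoid ℓ ℓ) : (s t : Expr (Setoid.Carrier S)) → Set ℓ where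
  leaf : ∀ {x y} → Setoid._≈_ S x y → S ⊢ leaf x ≋ leaf y
  _·_  : ∀ {s s′ t t′} → S ⊢ s ≋ s′ → S ⊢ t ≋ t′ → S ⊢ s · t ≋ s′ · t′

mapExpr : ∀ {A B : Set ℓ} → (A → B) → Expr A → Expr B
mapExpr f (leaf x) = leaf (f x)
mapExpr f (s · t)  = mapExpr f s · mapExpr f t

evaluate : (F : FreeMagma ℓ) → Expr (Setoid.Carrier (Generators F)) →
           FreeMagma.Carrier F
evaluate F (leaf x) = proj₁ x
evaluate F (s · t)  = evaluate F s ∙ evaluate F t
  where open FreeMagma F

-- Expressions over a countable inhabited set form a countable magma.
private
  pair : ℕ → ℕ → ℕ
  pair zero    n = suc (2 * n)
  pair (suc m) n = 2 * pair m n

  double-injective : ∀ {m n} → 2 * m ≡ 2 * n → m ≡ n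
  double-injective {m} {n} = *-cancelˡ-≡ m n 2

  pair-injective : ∀ m {n} m′ {n′} → pair m n ≡ pair m′ n′ → m ≡ m′ × n ≡ n′
  pair-injective zero        zero          eq =
    ≡.refl , double-injective (suc-injective eq)
  pair-injective zero    {n} (suc m′) {n′} eq =
    contradiction (≡.sym eq) (even≢odd (pair m′ n′) n)
  pair-injective (suc m) {n} zero     {n′} eq =
    contradiction eq (even≢odd (pair m n) n′)
  pair-injective (suc m) {n} (suc m′) {n′} eq
    with pair-injective m {n} m′ {n′} (double-injective eq)
  ... | ≡.refl , n≡n′ = ≡.refl , n≡n′

module _ (S : Setoid ℓ ℓ) where
  private
    module S = Setoid S

  ≋-refl : ∀ {t} → S ⊢ t ≋ t
  ≋-refl {leaf x} = leaf S.refl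
  ≋-refl {s · t}  = ≋-refl · ≋-refl

  ≋-sym : ∀ {s t} → S ⊢ s ≋ t → S ⊢ t ≋ s
  ≋-sym (leaf p) = leaf (S.sym p)
  ≋-sym (p · q)  = ≋-sym p · ≋-sym q

  ≋-trans : ∀ {s t u} → S ⊢ s ≋ t → S ⊢ t ≋ u → S ⊢ s ≋ u
  ≋-trans (leaf p) (leaf q)  = leaf (S.trans p q)
  ≋-trans (p · q)  (p′ · q′) = ≋-trans p p′ · ≋-trans q q′

  exprMagma : Magma ℓ ℓ
  exprMagma = record
    { Carrier = Expr S.Carrier
    ; _≈_     = S ⊢_≋_
    ; _∙_     = _·_
    ; isMagma = record
      { isEquivalence = record { refl = ≋-refl ; sym = ≋-sym ; trans = ≋-trans }
      ; ∙-cong        = _·_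
      }
    }

  private
    module _ (c : Countable S) where
      open Injection c

      code : Expr S.Carrier → ℕ
      code (leaf x) = 2 * to x
      code (s · t)  = suc (2 * pair (code s) (code t))

      code-cong : ∀ {s t} → S ⊢ s ≋ t → code s ≡ code t
      code-cong (leaf p) = ≡.cong (2 *_) (cong p)
      code-cong (p · q)  =
        ≡.cong₂ (λ m n → suc (2 * pair m n)) (code-cong p) (code-cong q)

      code-injective : ∀ s t → code s ≡ code t → S ⊢ s ≋ t
      code-injective (leaf x) (leaf y)  eq = leaf (injective (double-injective eq))
      code-injective (leaf x) (s · t)   eq =
        contradiction eq (even≢odd (to x) (pair (code s) (code t)))
      code-injective (s · t)  (leaf x)  eq =
        contradiction (≡.sym eq) (even≢odd (to x) (pair (code s) (code t)))
      code-injective (s · t)  (s′ · t′) eq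
        with p , q ← pair-injective (code s) (code s′)
                       (double-injective (suc-injective eq))
        = code-injective s s′ p · code-injective t t′ q

  exprCountableMagma : S.Carrier → Countable S → CountableMagma ℓ
  exprCountableMagma x c = record
    { magma     = exprMagma
    ; point     = leaf x
    ; countable = record
      { to        = code c
      ; cong      = code-cong c
      ; injective = λ {s} {t} → code-injective c s t
      }
    }

module _ (F : FreeMagma ℓ) where
  private
    module F = FreeMagma F
    module ι = Func F.ι
    X = Generators F
    module X = Setoid X
    open MagmaHomomorphism using (⟦_⟧; homo; ⟦⟧-cong)

  generator : Setoid.Carrier F.Y → X.Carrier
  generator y = ι.to y , y , F.refl

  private
    X-countable : Countable X
    X-countable = record
      { to        = λ x → to (proj₁ x)
      ; cong      = cong
      ; injective = injective
      }
      where open Injection F.countable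

    -- X is inhabited: map F to the left-zero band on X ⊎ Bool.  Exchanging the
    -- two booleans fixes the image of F pointwise, so that image lies in X.
    leftZero : CountableMagma ℓ
    leftZero = record
      { magma     = record
        { Carrier = X.Carrier ⊎ Bool
        ; _≈_     = L._≈_
        ; _∙_     = λ a b → a
        ; isMagma = record
          { isEquivalence = L.isEquivalence
          ; ∙-cong        = λ p q → p
          }
        }
      ; point     = inj₂ true
      ; countable = record { to = code ; cong = cong′ ; injective = λ {a} {b} → inj′ a b }
      }
      where
      module L = Setoid (X ⊎ₛ ≡.setoid Bool)
      open Injection X-countable
      code : X.Carrier ⊎ Bool → ℕ
      code (inj₁ x)     = 2 + to x
      code (inj₂ true)  = 1
      code (inj₂ false) = 0
      cong′ : ∀ {a b} → a L.≈ b → code a ≡ code b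
      cong′ (inj₁ {x} {y} p) = ≡.cong (2 +_) (cong {x} {y} p)
      cong′ (inj₂ ≡.refl)    = ≡.refl
      inj′ : ∀ a b → code a ≡ code b → a L.≈ b
      inj′ (inj₁ x)     (inj₁ y)     eq =
        inj₁ (injective {x} {y} (suc-injective (suc-injective eq)))
      inj′ (inj₁ x)     (inj₂ true)  ()
      inj′ (inj₁ x)     (inj₂ false) ()
      inj′ (inj₂ true)  (inj₁ y)     ()
      inj′ (inj₂ false) (inj₁ y)     ()
      inj′ (inj₂ true)  (inj₂ true)  eq = inj₂ ≡.refl
      inj′ (inj₂ true)  (inj₂ false) ()
      inj′ (inj₂ false) (inj₂ true)  ()
      inj′ (inj₂ false) (inj₂ false) eq = inj₂ ≡.refl

    X-point : X.Carrier
    X-point = extract (⟦ θ ⟧ F.point) (θ-unique {swapped} θ-extends′ F.point)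
      where
      module L = CountableMagma leftZero
      universal = F.isFree leftZero record
        { to   = λ y → inj₁ (generator y)
        ; cong = λ p → inj₁ (ι.cong p)
        }
      θ         = proj₁ universal
      θ-extends = proj₁ (proj₂ universal)
      θ-unique  = proj₂ (proj₂ universal)

      swap : L.Carrier → L.Carrier
      swap (inj₁ x) = inj₁ x
      swap (inj₂ b) = inj₂ (not b)

      swap-cong : ∀ {a b} → a L.≈ b → swap a L.≈ swap b
      swap-cong (inj₁ p) = inj₁ p
      swap-cong (inj₂ p) = inj₂ (≡.cong not p)

      swapped : Morphism F.countableMagma leftZero
      swapped = record
        { ⟦_⟧ = λ m → swap (⟦ θ ⟧ m)
        ; isMagmaHomomorphism = record
          { isRelHomomorphism = record { cong = λ p → swap-cong (⟦⟧-cong θ p) }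
          ; homo              = λ m n → swap-cong (homo θ m n)
          }
        }

      θ-extends′ : ∀ y → swap (⟦ θ ⟧ (ι.to y)) L.≈ inj₁ (generator y)
      θ-extends′ y = swap-cong (θ-extends y)

      extract : ∀ a → a L.≈ swap a → X.Carrier
      extract (inj₁ x)     p         = x
      extract (inj₂ true)  (inj₂ ())
      extract (inj₂ false) (inj₂ ())

    exprs : CountableMagma ℓ
    exprs = exprCountableMagma X X-point X-countable

    universal = F.isFree exprs record
      { to   = λ y → leaf (generator y)
      ; cong = λ p → leaf (ι.cong p)
      }

    δ : Morphism F.countableMagma exprs
    δ = proj₁ universal

    δ-extends : ∀ y → X ⊢ ⟦ δ ⟧ (ι.to y) ≋ leaf (generator y)
    δ-extends = proj₁ (proj₂ universal)

    evaluate-cong : ∀ {s t} → X ⊢ s ≋ t → evaluate F s F.≈ evaluate F t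
    evaluate-cong (leaf p) = p
    evaluate-cong (p · q)  = F.∙-cong (evaluate-cong p) (evaluate-cong q)

    evaluate-δ : ∀ u → evaluate F (⟦ δ ⟧ u) F.≈ u
    evaluate-δ u = F.trans (F.sym (unique {evalδ} evalδ-extends u))
                           (unique {identity} (λ y → F.refl) u)
      where
      unique   = proj₂ (proj₂ (F.isFree F.countableMagma F.ι))
      identity : Morphism F.countableMagma F.countableMagma
      identity = record
        { ⟦_⟧ = λ m → m
        ; isMagmaHomomorphism = record
          { isRelHomomorphism = record { cong = λ p → p }
          ; homo              = λ m n → F.refl
          }
        }
      evalδ : Morphism F.countableMagma F.countableMagma
      evalδ = record
        { ⟦_⟧ = λ m → evaluate F (⟦ δ ⟧ m)
        ; isMagmaHomomorphism = record
          { isRelHomomorphism = record { cong = λ p → evaluate-cong (⟦⟧-cong δ p) }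
          ; homo              = λ m n → evaluate-cong (homo δ m n)
          }
        }
      evalδ-extends : ∀ y → evaluate F (⟦ δ ⟧ (ι.to y)) F.≈ ι.to y
      evalδ-extends y = evaluate-cong (δ-extends y)

    δ-evaluate : ∀ t → X ⊢ ⟦ δ ⟧ (evaluate F t) ≋ t
    δ-evaluate (leaf (x , y , ιy≈x)) =
      ≋-trans X (⟦⟧-cong δ (F.sym ιy≈x)) (≋-trans X (δ-extends y) (leaf ιy≈x))
    δ-evaluate (s · t) =
      ≋-trans X (homo δ _ _) (δ-evaluate s · δ-evaluate t)

  decomposition : ∀ u → ∃! (X ⊢_≋_) λ t → evaluate F t F.≈ u
  decomposition u = ⟦ δ ⟧ u , evaluate-δ u , λ {t} p →
    ≋-trans X (⟦⟧-cong δ (F.sym p)) (δ-evaluate t)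

  decompose : F.Carrier → Expr X.Carrier
  decompose u = proj₁ (decomposition u)

module _ (Fᵢ Fⱼ : FreeMagma ℓ)
         (σ : Bijection (Generators Fᵢ) (Generators Fⱼ)) where
  private
    module Fᵢ = FreeMagma Fᵢ
    module Fⱼ = FreeMagma Fⱼ
    module σ = Bijection σ

  -- A generator is its own decomposition, so the clause Υ(x) = σ(x) for
  -- generators is the one-leaf case of this formula; see Υ-generator.
  Υ : Fᵢ.Carrier → Fⱼ.Carrier
  Υ u = evaluate Fⱼ (mapExpr σ.to (decompose Fᵢ u))

  Υ-generator : ∀ x → Υ (proj₁ x) Fⱼ.≈ proj₁ (σ.to x)
  Υ-generator x
    with decompose Fᵢ (proj₁ x)
       | proj₂ (proj₂ (decomposition Fᵢ (proj₁ x))) {leaf x} Fᵢ.refl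
  ... | leaf _ | leaf p = σ.cong p

{-# OPTIONS --safe #-}
-- Decomposition and evaluation are mutually inverse morphisms between a free
-- magma and the magma of bracketed expressions over its generators.  Under this
-- identification Υ is the functorial action of σ on expressions, so the inverse
-- of Υ is the action of σ⁻¹.
module Submission where

open import Defs
open import Algebra.Morphism.Structures using (IsMagmaHomomorphism)
open import Data.Product using (proj₁; proj₂)
open import Function.Bundles using (Bijection; Func; Inverse)
open import Function.Properties.Bijection using (Bijection⇒Inverse)
open import Level using (Level)
open import Relation.Binary.Bundles using (Setoid)

private
  variable
    ℓ : Level

mapExpr-cong : ∀ {S T : Setoid ℓ ℓ} (f : Func S T) {s t} →
  S ⊢ s ≋ t → T ⊢ mapExpr (Func.to f) s ≋ mapExpr (Func.to f) t
mapExpr-cong f (leaf p) = leaf (Func.cong f p)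
mapExpr-cong f (p · q)  = mapExpr-cong f p · mapExpr-cong f q

mapExpr-inverse : ∀ (S : Setoid ℓ ℓ) {B : Set ℓ}
  {f : Setoid.Carrier S → B} {g : B → Setoid.Carrier S} →
  (∀ x → Setoid._≈_ S (g (f x)) x) → ∀ t → S ⊢ mapExpr g (mapExpr f t) ≋ t
mapExpr-inverse S gf (leaf x) = leaf (gf x)
mapExpr-inverse S gf (s · t)  = mapExpr-inverse S gf s · mapExpr-inverse S gf t

module _ (F : FreeMagma ℓ) where
  private
    module F = FreeMagma F
    X = Generators F

  evaluate-cong : ∀ {s t} → X ⊢ s ≋ t → evaluate F s F.≈ evaluate F t
  evaluate-cong (leaf p) = p
  evaluate-cong (p · q)  = F.∙-cong (evaluate-cong p) (evaluate-cong q)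

  evaluate-decompose : ∀ u → evaluate F (decompose F u) F.≈ u
  evaluate-decompose u = proj₁ (proj₂ (decomposition F u))

  -- The uniqueness half of `decomposition`: to identify a decomposition it is enough to exhibit an
  -- expression with the right value.
  decompose-unique : ∀ {u t} → evaluate F t F.≈ u → X ⊢ decompose F u ≋ t
  decompose-unique {u} = proj₂ (proj₂ (decomposition F u))

  decompose-cong : ∀ {u v} → u F.≈ v → X ⊢ decompose F u ≋ decompose F v
  decompose-cong {u} {v} p =
    decompose-unique (F.trans (evaluate-decompose v) (F.sym p))

  -- The product of the two decompositions evaluates to `u F.∙ v`, so uniqueness applies.
  decompose-homo : ∀ u v → X ⊢ decompose F (u F.∙ v) ≋ decompose F u · decompose F v
  decompose-homo u v =
    decompose-unique (F.∙-cong (evaluate-decompose u) (evaluate-decompose v))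

module _ (F G : FreeMagma ℓ) where
  private
    module F = FreeMagma F
    module G = FreeMagma G
    X = Generators F
    Z = Generators G

  -- The formula of `Υ` for an arbitrary map of generators, so that `σ` and its inverse are handled
  -- by the same lemmas.
  extend : (Setoid.Carrier X → Setoid.Carrier Z) → F.Carrier → G.Carrier
  extend f u = evaluate G (mapExpr f (decompose F u))

  extend-isMagmaHomomorphism : (f : Func X Z) →
    IsMagmaHomomorphism F.rawMagma G.rawMagma (extend (Func.to f))
  extend-isMagmaHomomorphism f = record
    { isRelHomomorphism = record
      { cong = λ p → evaluate-cong G (mapExpr-cong f (decompose-cong F p)) }
    -- `mapExpr` and `evaluate` preserve products definitionally; only `decompose` contributes a
    -- proof.
    ; homo = λ u v → evaluate-cong G (mapExpr-cong f (decompose-homo F u v))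
    }

extend-inverse : (F G : FreeMagma ℓ)
  (f : Func (Generators F) (Generators G)) (g : Func (Generators G) (Generators F)) →
  (∀ x → Setoid._≈_ (Generators F) (Func.to g (Func.to f x)) x) →
  ∀ u → FreeMagma._≈_ F (extend G F (Func.to g) (extend F G (Func.to f) u)) u
extend-inverse F G f g gf u = F.trans
  (evaluate-cong F (≋-trans (Generators F)
    -- `extend` at `u` is by definition the value of the relabelled expression, so decomposing it in
    -- `G` returns that expression.
    (mapExpr-cong g (decompose-unique G G.refl))
    (mapExpr-inverse (Generators F) gf (decompose F u))))
  (evaluate-decompose F u)
  where
  module F = FreeMagma F
  module G = FreeMagma G

corollary1 : ∀ {ℓ} (𝔽ᵢ 𝔽ⱼ : FreeMagma ℓ) (σ : Bijection (Generators 𝔽ᵢ) (Generators 𝔽ⱼ)) →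
    IsIsomorphism (FreeMagma.countableMagma 𝔽ᵢ) (FreeMagma.countableMagma 𝔽ⱼ) (Υ 𝔽ᵢ 𝔽ⱼ σ)
corollary1 𝔽ᵢ 𝔽ⱼ σ = record
  { isMagmaHomomorphism = extend-isMagmaHomomorphism 𝔽ᵢ 𝔽ⱼ to
  ; inverse             = record
    { isMagmaHomomorphism = extend-isMagmaHomomorphism 𝔽ⱼ 𝔽ᵢ from }
  ; inverseˡ            = extend-inverse 𝔽ⱼ 𝔽ᵢ from to σ⁻¹.strictlyInverseˡ
  ; inverseʳ            = extend-inverse 𝔽ᵢ 𝔽ⱼ to from σ⁻¹.strictlyInverseʳ
  }
  where
  -- Its forward map is definitionally that of `σ`, so `extend` along `to` is `Υ` itself; the
  -- backward map picks preimages by surjectivity and respects equality by injectivity.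
  module σ⁻¹ = Inverse (Bijection⇒Inverse σ)
  to : Func (Generators 𝔽ᵢ) (Generators 𝔽ⱼ)
  to = record { to = σ⁻¹.to ; cong = σ⁻¹.to-cong }
  from : Func (Generators 𝔽ⱼ) (Generators 𝔽ᵢ)
  from = record { to = σ⁻¹.from ; cong = σ⁻¹.from-cong }
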